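{- Let $G$ be a connected non-bipartite graph and let $\Gamma=(G,\sigma)\in\mathbb{FS}_1(G)$ with principal weak automorphism $\varphi$ of order $2$ whose set of fixed vertices $F$ is nonempty. Suppose $\Gamma$ has only one $\varphi$-factor, so that $V(G)=F\cup U_1\cup U_2$ with $\varphi(U_1)=U_2$ and $G[U_1\cup U_2]$ the unique $\varphi$-factor. Then, for some bipartition $(\Omega_1,\Omega_2)$ of the bipartite graph $G[F]$, $\Gamma$ is switching isomorphic to a signed graph $\hat\Gamma^a$ or $\hat\Gamma^b$ whose adjacency matrix, with rows and columns in the block order $\Omega_1,\Omega_2,U_1,U_2$, has respectively the form $$A(\hat\Gamma^a)=\begin{pmatrix} 0 & A & D_1 & D_1 \\ A^\top & 0 & D_2 & -D_2 \\ D_1^\top & D_2^\top & B & Y \\ D_1^\top & -D_2^\top & -Y & -B \end{pmatrix},\qquad A(\hat\Gamma^b)=\begin{pmatrix} 0 & A & D_1 & -D_1 \\ A^\top & 0 & D_2 & D_2 \\ D_1^\top & D_2^\top & B & Y \\ -D_1^\top & D_2^\top & -Y & -B \end{pmatrix},$$ where $A,B,Y,D_1,D_2$ are matrices with entries in $\{0,1,-1\}$, $B^\top=B$ has zero diagonal, and $Y^\top=-Y$.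
   Context: Graphs are finite and simple. A signed graph $\Gamma=(G,\sigma)$ on $G$ is $G$ with a function $\sigma:E(G)\to\{+1,-1\}$; its adjacency matrix has $(u,v)$-entry $\sigma(uv)$ if $uv\in E(G)$ and $0$ otherwise. Switching $\Gamma$ with respect to $U\subseteq V(G)$ reverses the signs of all edges between $U$ and $V(G)\setminus U$. $\Gamma\simeq\Gamma'$ (switching isomorphic) means $\Gamma$ is isomorphic, by a sign-preserving graph isomorphism, to a switching of $\Gamma'$. $\Gamma$ is sign-symmetric if $\Gamma\simeq-\Gamma=(G,-\sigma)$. The sign of a cycle is the product of the signs of its edges. A weak automorphism of $\Gamma$ is a $\varphi\in Aut(G)$ with $\sigma(\varphi(C))=-\sigma(C)$ for every odd cycle $C$ of $G$ and $\sigma(\varphi(C))=\sigma(C)$ for every even cycle $C$. It is principal if it has the smallest order among all weak automorphisms of $\Gamma$. $\mathbb{S}_1(G)$ is the set of sign-symmetric signed graphs on $G$ having a principal weak automorphism of order $2$; for such $\varphi$, $F=\{v\in V(G)\mid\varphi(v)=v\}$, and $G[F]$ is a bipartite graph. $\mathbb{FS}_1(G)$ is the set of $\Gamma\in\mathbb{S}_1(G)$ with $F\neq\emptyset$ (for some such $\varphi$). $\varphi$-factors: $\varphi$ permutes the connected components of $G[V(G)\setminus F]$. A reflexive factor is a component mapped to itself by $\varphi$; a symmetric factor is the union of two distinct components interchanged by $\varphi$. These are the $\varphi$-factors. For each $\varphi$-factor the vertex set is written as a disjoint union of two sets interchanged by $\varphi$, each inducing a connected subgraph. "Bipartition $(\Omega_1,\Omega_2)$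 of $G[F]$" means $F=\Omega_1\sqcup\Omega_2$ with no edges inside $\Omega_1$ or inside $\Omega_2$ (one part may be empty). -}

module Defs where

open import Data.Bool.Base using (Bool; true; false; _xor_; if_then_else_)
open import Data.Bool.Properties using (xor-comm)
open import Data.Fin.Base using (Fin)
open import Data.Fin.Permutation using (Permutation; _⟨$⟩ʳ_; _⟨$⟩ˡ_)
open import Data.Fin.Properties using (_≟_)
open import Data.Fin.Subset using (Subset; _∈_; _⊆_; _∩_; _∪_; ∁; ⊤; Empty; Nonempty)
open import Data.Integer.Base as ℤ using (ℤ; 0ℤ; 1ℤ; -1ℤ; _◃_)
open import Data.List.Base as List using (List)
open import Data.List.Relation.Unary.Unique.Propositional using (Unique)
import Data.List.Relation.Unary.Unique.Propositional.Properties as Unique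
open import Data.Nat.Base using (ℕ; zero; suc; _+_; _≤_; _<_)
open import Data.Nat.Divisibility using (_∣_)
open import Data.Nat.GeneralisedArithmetic using (iterate)
open import Data.Product.Base using (∃; ∃₂; _×_; _,_)
open import Data.Sign.Base as Sign using (Sign; opposite)
open import Data.Sum.Base using (_⊎_)
open import Data.Vec.Base using (lookup; tabulate)
open import Data.Vec.Functional using (Vector; _++_)
open import Function.Base using (_∘_)
open import Function.Bundles using (module Inverse)
open import Function.Definitions using (Injective)
open import Level using (0ℓ)
open import Relation.Binary.Construct.Closure.ReflexiveTransitive using (Star; ε; _◅_; gmap)
open import Relation.Binary.Core using (Rel)
open import Relation.Binary.Definitions using (Decidable; Irreflexive; Symmetric)
open import Relation.Binary.PropositionalEquality
  using (_≡_; _≢_; _≗_; refl; sym; trans; cong; cong₂; subst)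
open import Relation.Nullary.Decidable using (yes; no; does)
open import Relation.Nullary.Negation using (¬_)

private
  variable
    m n p q r s : ℕ

record Graph (n : ℕ) : Set₁ where
  field
    Adj        : Rel (Fin n) 0ℓ
    adj?       : Decidable Adj
    adj-sym    : Symmetric Adj
    adj-irrefl : Irreflexive _≡_ Adj

open Graph public

Induced : Graph n → Subset n → Rel (Fin n) 0ℓ
Induced G S u v = u ∈ S × v ∈ S × Adj G u v

ConnectedOn : Graph n → Subset n → Set
ConnectedOn G S = Nonempty S × (∀ {u v} → u ∈ S → v ∈ S → Star (Induced G S) u v)

Connected : Graph n → Set
Connected G = ConnectedOn G ⊤

record IsBipartition (G : Graph n) (S Ω₁ Ω₂ : Subset n) : Set where
  field
    cover        : S ≡ Ω₁ ∪ Ω₂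
    disjoint     : Empty (Ω₁ ∩ Ω₂)
    independent₁ : ∀ {u v} → u ∈ Ω₁ → v ∈ Ω₁ → ¬ Adj G u v
    independent₂ : ∀ {u v} → u ∈ Ω₂ → v ∈ Ω₂ → ¬ Adj G u v

Bipartite : Graph n → Set
Bipartite G = ∃₂ λ Ω₁ Ω₂ → IsBipartition G ⊤ Ω₁ Ω₂

-- The vertex sets of the connected components of G[W].
record IsComponent (G : Graph n) (W C : Subset n) : Set where
  field
    inside    : C ⊆ W
    connected : ConnectedOn G C
    maximal   : ∀ {D} → D ⊆ W → ConnectedOn G D → C ⊆ D → D ⊆ C

record _≅_ (G : Graph m) (H : Graph n) : Set where
  field
    perm      : Permutation m n
    preserves : ∀ {u v} → Adj G u v → Adj H (perm ⟨$⟩ʳ u) (perm ⟨$⟩ʳ v)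
    reflects  : ∀ {u v} → Adj H (perm ⟨$⟩ʳ u) (perm ⟨$⟩ʳ v) → Adj G u v

open _≅_ public

Aut : Graph n → Set
Aut G = G ≅ G

⟦_⟧ : {G : Graph m} {H : Graph n} → G ≅ H → Fin m → Fin n
⟦ φ ⟧ = perm φ ⟨$⟩ʳ_

Fix : {G : Graph n} → Aut G → Subset n
Fix φ = tabulate λ v → does (⟦ φ ⟧ v ≟ v)

image : {G : Graph n} → Aut G → Subset n → Subset n
image φ S = tabulate λ v → lookup S (perm φ ⟨$⟩ˡ v)

IsIdentityPower : {G : Graph n} → Aut G → ℕ → Set
IsIdentityPower φ k = ∀ v → iterate ⟦ φ ⟧ v k ≡ v

record HasOrder {G : Graph n} (φ : Aut G) (k : ℕ) : Set where
  field
    positive : 0 < k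
    identity : IsIdentityPower φ k
    least    : ∀ {j} → 0 < j → IsIdentityPower φ j → k ≤ j

-- The irrelevant argument makes the sign a function of the edge alone,
-- independent of the proof of adjacency.
record SignedGraph (G : Graph n) : Set where
  field
    σ     : ∀ {u v} → .(Adj G u v) → Sign
    σ-sym : ∀ {u v} (e : Adj G u v) → σ (adj-sym G e) ≡ σ e

open SignedGraph public

Matrix : ℕ → ℕ → Set
Matrix m n = Vector (Vector ℤ n) m

adjacencyMatrix : {G : Graph n} → SignedGraph G → Matrix n n
adjacencyMatrix {G = G} Γ u v with adj? G u v
... | yes e = σ Γ e ◃ 1
... | no  _ = 0ℤ

negate : {G : Graph n} → SignedGraph G → SignedGraph G
negate Γ = record
  { σ     = λ e → opposite (σ Γ e)
  ; σ-sym = λ e → cong opposite (σ-sym Γ e)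
  }

switch : {G : Graph n} → Subset n → SignedGraph G → SignedGraph G
switch U Γ = record
  { σ     = λ {u} {v} e → reverseIf (lookup U u xor lookup U v) (σ Γ e)
  ; σ-sym = λ {u} {v} e → cong₂ reverseIf (xor-comm (lookup U v) (lookup U u)) (σ-sym Γ e)
  }
  where
  reverseIf : Bool → Sign → Sign
  reverseIf b t = if b then opposite t else t

record _≅ₛ_ {G : Graph m} {H : Graph n} (Γ : SignedGraph G) (Δ : SignedGraph H) : Set where
  field
    iso            : G ≅ H
    sign-preserved : ∀ {u v} (e : Adj G u v) → σ Δ (preserves iso e) ≡ σ Γ e

infix 4 _≅_ _≅ₛ_ _≃_

_≃_ : {G : Graph m} {H : Graph n} → SignedGraph G → SignedGraph H → Set
Γ ≃ Δ = ∃ λ U → Γ ≅ₛ switch U Δ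

SignSymmetric : {G : Graph n} → SignedGraph G → Set
SignSymmetric Γ = Γ ≃ negate Γ

module _ {G : Graph n} where

  vertices : ∀ {u v} → Star (Adj G) u v → List (Fin n)
  vertices {u} ε       = u List.∷ List.[]
  vertices {u} (_ ◅ w) = u List.∷ vertices w

  edgeCount : ∀ {u v} → Star (Adj G) u v → ℕ
  edgeCount ε       = 0
  edgeCount (_ ◅ w) = suc (edgeCount w)

  pathSign : SignedGraph G → ∀ {u v} → Star (Adj G) u v → Sign
  pathSign Γ ε       = Sign.+
  pathSign Γ (e ◅ w) = σ Γ e Sign.* pathSign Γ w

-- Cycles carry a base point and a direction, on which neither their
-- length nor their sign depends.
record Cycle (G : Graph n) : Set where
  field
    {start end} : Fin n
    path        : Star (Adj G) start end
    closing     : Adj G end start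
    distinct    : Unique (vertices {G = G} path)
    long        : 2 ≤ edgeCount {G = G} path

open Cycle public

cycleLength : {G : Graph n} → Cycle G → ℕ
cycleLength {G = G} C = suc (edgeCount {G = G} (path C))

cycleSign : {G : Graph n} → SignedGraph G → Cycle G → Sign
cycleSign Γ C = σ Γ (closing C) Sign.* pathSign Γ (path C)

module _ {G : Graph n} (φ : Aut G) where

  mapPath : ∀ {u v} → Star (Adj G) u v → Star (Adj G) (⟦ φ ⟧ u) (⟦ φ ⟧ v)
  mapPath = gmap ⟦ φ ⟧ (preserves φ)

  vertices-mapPath : ∀ {u v} (w : Star (Adj G) u v) →
                     vertices {G = G} (mapPath w) ≡ List.map ⟦ φ ⟧ (vertices {G = G} w)
  vertices-mapPath ε       = refl
  vertices-mapPath (_ ◅ w) = cong (_ List.∷_) (vertices-mapPath w)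

  edgeCount-mapPath : ∀ {u v} (w : Star (Adj G) u v) →
                      edgeCount {G = G} (mapPath w) ≡ edgeCount {G = G} w
  edgeCount-mapPath ε       = refl
  edgeCount-mapPath (_ ◅ w) = cong suc (edgeCount-mapPath w)

  ⟦⟧-injective : Injective _≡_ _≡_ ⟦ φ ⟧
  ⟦⟧-injective eq =
    trans (sym (strictlyInverseʳ _)) (trans (cong from eq) (strictlyInverseʳ _))
    where open Inverse (perm φ)

  mapCycle : Cycle G → Cycle G
  mapCycle C = record
    { path     = mapPath (path C)
    ; closing  = preserves φ (closing C)
    ; distinct = subst Unique (sym (vertices-mapPath (path C)))
                       (Unique.map⁺ ⟦⟧-injective (distinct C))
    ; long     = subst (2 ≤_) (sym (edgeCount-mapPath (path C))) (long C)
    }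

record IsWeakAutomorphism {G : Graph n} (Γ : SignedGraph G) (φ : Aut G) : Set where
  field
    odd-cycles  : ∀ C → ¬ (2 ∣ cycleLength C) →
                  cycleSign Γ (mapCycle φ C) ≡ opposite (cycleSign Γ C)
    even-cycles : ∀ C → 2 ∣ cycleLength C →
                  cycleSign Γ (mapCycle φ C) ≡ cycleSign Γ C

record IsPrincipal {G : Graph n} (Γ : SignedGraph G) (φ : Aut G) : Set where
  field
    weak     : IsWeakAutomorphism Γ φ
    smallest : ∀ ψ {j k} → IsWeakAutomorphism Γ ψ → HasOrder φ k → HasOrder ψ j → k ≤ j

S₁ : {G : Graph n} → SignedGraph G → Set
S₁ Γ = SignSymmetric Γ × ∃ λ φ → IsPrincipal Γ φ × HasOrder φ 2

FS₁ : {G : Graph n} → SignedGraph G → Set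
FS₁ Γ = S₁ Γ × ∃ λ φ → IsPrincipal Γ φ × HasOrder φ 2 × Nonempty (Fix φ)

-- φ-factors are identified with their vertex sets.
module _ {G : Graph n} (φ : Aut G) where

  IsReflexiveFactor : Subset n → Set
  IsReflexiveFactor S = IsComponent G (∁ (Fix φ)) S × image φ S ≡ S

  record IsSymmetricFactor (S : Subset n) : Set where
    field
      {C₁ C₂}    : Subset n
      component₁ : IsComponent G (∁ (Fix φ)) C₁
      component₂ : IsComponent G (∁ (Fix φ)) C₂
      distinct   : C₁ ≢ C₂
      swap₁      : image φ C₁ ≡ C₂
      swap₂      : image φ C₂ ≡ C₁
      union      : S ≡ C₁ ∪ C₂

  IsFactor : Subset n → Set
  IsFactor S = IsReflexiveFactor S ⊎ IsSymmetricFactor S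

  record IsHalving (S U₁ U₂ : Subset n) : Set where
    field
      cover      : S ≡ U₁ ∪ U₂
      disjoint   : Empty (U₁ ∩ U₂)
      swap₁      : image φ U₁ ≡ U₂
      swap₂      : image φ U₂ ≡ U₁
      connected₁ : ConnectedOn G U₁
      connected₂ : ConnectedOn G U₂

  IsUniqueFactor : Subset n → Set
  IsUniqueFactor S = IsFactor S × (∀ {T} → IsFactor T → T ≡ S)

infixr 7 _∥_
infixr 6 _⫽_
infix  9 _ᵀ
infix  8 −_

_∥_ : Matrix m p → Matrix m q → Matrix m (p + q)
(M ∥ N) i = M i ++ N i

_⫽_ : Matrix p n → Matrix q n → Matrix (p + q) n
_⫽_ = _++_

_ᵀ : Matrix m n → Matrix n m
(M ᵀ) i j = M j i

−_ : Matrix m n → Matrix m n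
(− M) i j = ℤ.- M i j

𝟎 : ∀ m n → Matrix m n
𝟎 _ _ _ _ = 0ℤ

infix 4 _≈_

_≈_ : Matrix m n → Matrix m n → Set
M ≈ N = ∀ i j → M i j ≡ N i j

SignEntries : Matrix m n → Set
SignEntries M = ∀ i j → M i j ≡ 0ℤ ⊎ M i j ≡ 1ℤ ⊎ M i j ≡ -1ℤ

record Blocks (p q r : ℕ) : Set where
  field
    A  : Matrix p q
    B  : Matrix r r
    Y  : Matrix r r
    D₁ : Matrix p r
    D₂ : Matrix q r
    A-entries   : SignEntries A
    B-entries   : SignEntries B
    Y-entries   : SignEntries Y
    D₁-entries  : SignEntries D₁
    D₂-entries  : SignEntries D₂
    B-symmetric : B ᵀ ≈ B
    B-diagonal  : ∀ i → B i i ≡ 0ℤ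
    Y-skew      : Y ᵀ ≈ − Y

formᵃ : Blocks p q r → Matrix (p + (q + (r + r))) (p + (q + (r + r)))
formᵃ {p} {q} blocks =
    (𝟎 p p ∥ A        ∥ D₁  ∥ D₁  )
  ⫽ (A ᵀ   ∥ 𝟎 q q    ∥ D₂  ∥ − D₂)
  ⫽ (D₁ ᵀ  ∥ D₂ ᵀ     ∥ B   ∥ Y   )
  ⫽ (D₁ ᵀ  ∥ − (D₂ ᵀ) ∥ − Y ∥ − B )
  where open Blocks blocks

formᵇ : Blocks p q r → Matrix (p + (q + (r + r))) (p + (q + (r + r)))
formᵇ {p} {q} blocks =
    (𝟎 p p    ∥ A     ∥ D₁  ∥ − D₁)
  ⫽ (A ᵀ      ∥ 𝟎 q q ∥ D₂  ∥ D₂  )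
  ⫽ (D₁ ᵀ     ∥ D₂ ᵀ  ∥ B   ∥ Y   )
  ⫽ (− (D₁ ᵀ) ∥ D₂ ᵀ  ∥ − Y ∥ − B )
  where open Blocks blocks

record Enumerates (ω : Vector (Fin n) s) (S : Subset n) : Set where
  field
    injective : Injective _≡_ _≡_ ω
    member    : ∀ i → ω i ∈ S
    complete  : ∀ {v} → v ∈ S → ∃ λ i → ω i ≡ v

-- The adjacency matrix of Γ, with rows and columns in the block order
-- Ω₁, Ω₂, U₁, U₂, has the given form. The rows of U₂ = φ(U₁) are listed
-- in the order φ carries over from U₁.
record HasForm {G : Graph n} (form : ∀ {p q r} → Blocks p q r →
                                     Matrix (p + (q + (r + r))) (p + (q + (r + r))))
               (φ : Aut G) (Ω₁ Ω₂ U₁ U₂ : Subset n) (Γ : SignedGraph G) : Set where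
  field
    {a b c} : ℕ
    ω₁      : Vector (Fin n) a
    ω₂      : Vector (Fin n) b
    u₁      : Vector (Fin n) c
    u₂      : Vector (Fin n) c
    enum-ω₁ : Enumerates ω₁ Ω₁
    enum-ω₂ : Enumerates ω₂ Ω₂
    enum-u₁ : Enumerates u₁ U₁
    enum-u₂ : Enumerates u₂ U₂
    aligned : u₂ ≗ ⟦ φ ⟧ ∘ u₁
    blocks  : Blocks a b c

  order : Vector (Fin n) (a + (b + (c + c)))
  order = ω₁ ++ (ω₂ ++ (u₁ ++ u₂))

  field
    matrix : (λ i j → adjacencyMatrix Γ (order i) (order j)) ≈ form blocks

{-# OPTIONS --safe #-}
module Submission where

-- Put δ(e) = −σ(e)σ(φ(e)). That φ is a weak automorphism says exactly that
-- every cycle has sign + under δ, so δ(uv) = θ(u)θ(v) for some θ : V → {±}.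
-- Since φ² = 1, δ is φ-invariant; as G is connected and φ has a fixed vertex,
-- θ ∘ φ = θ. An edge uv inside F is fixed by φ, so δ(uv) = − and θ separates
-- its ends: Ω₁ = F ∩ {θ = −} and Ω₂ = F ∩ {θ = +} bipartition G[F].
-- Let Γ̂ be Γ switched by χ, where χ = θ on U₂ and χ = + elsewhere. Then
-- σ̂(φ(u)φ(v)) = −τ(u)τ(v)σ̂(uv) with τ(v) = χ(φ(v))χ(v)θ(v), which is θ on F
-- and + on U₁ ∪ U₂. This single identity yields all blocks of the first form.

open import Defs
open import Data.Bool.Base using (Bool; true; false; if_then_else_)
open import Data.Fin.Base using (Fin; zero; suc; splitAt)
open import Data.Fin.Permutation using (_⟨$⟩ˡ_; inverseʳ; inverseˡ)
import Data.Fin.Permutation as Perm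
open import Data.Fin.Properties using (_≟_)
open import Data.Fin.Subset
  using (Subset; Nonempty; _∪_; _∩_; _∈_; _∉_; ∁; ⊤)
open import Data.Fin.Subset.Properties
  using (_∈?_; ∈⊤; x∈p∩q⁺; x∈p∩q⁻; x∈∁p⇒x∉p; p∪∁p≡⊤; ∩-distribˡ-∪; ∩-identityʳ)
open import Data.Integer.Base as ℤ using (ℤ; 0ℤ; 1ℤ; -1ℤ; _◃_)
open import Data.List.Base as List using (List)
open import Data.List.Membership.DecPropositional using () renaming (_∈?_ to ∈-dec)
open import Data.List.Membership.Propositional using () renaming (_∈_ to _∈ₗ_)
open import Data.List.Membership.Propositional.Properties
  using (∈-filter⁺; ∈-filter⁻; ∈-lookup; ∈-allFin)
open import Data.List.Relation.Binary.Subset.Propositional using () renaming (_⊆_ to _⊆ₗ_)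
open import Data.List.Relation.Unary.All as All using (All)
open import Data.List.Relation.Unary.All.Properties using (¬Any⇒All¬; anti-mono)
open import Data.List.Relation.Unary.AllPairs using ([]; _∷_)
open import Data.List.Relation.Unary.Any using (here; there; index)
open import Data.List.Relation.Unary.Any.Properties using (lookup-index)
open import Data.List.Relation.Unary.Unique.Propositional using (Unique)
open import Data.List.Relation.Unary.Unique.Propositional.Properties using (allFin⁺; filter⁺)
open import Data.Nat.Base using (ℕ; zero; suc; z≤n; s≤s)
open import Data.Nat.Divisibility using (_∣_; _∣?_; _∣0; ∣-refl; ∣m+n∣m⇒∣n; ∣m∣n⇒∣m+n)
open import Data.Product.Base using (∃; ∃₂; _×_; _,_; proj₁; proj₂)
open import Data.Sign.Base using (Sign; +; -; opposite; _*_)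
open import Data.Sign.Properties as Sign using (opposite-involutive; s*s≡+)
open import Data.Sum.Base using (_⊎_; inj₁; inj₂)
open import Data.Vec.Base using (lookup; tabulate)
open import Data.Vec.Functional using (Vector; _++_)
open import Data.Vec.Properties using (lookup∘tabulate; []=⇒lookup; lookup⇒[]=)
open import Function.Base using (_∘_)
open import Function.Definitions using (Injective)
open import Level using (Level)
open import Relation.Binary.Construct.Closure.ReflexiveTransitive
  using (Star; ε; _◅_; _◅◅_) renaming (map to mapStar)
open import Relation.Binary.PropositionalEquality
  using (_≡_; refl; sym; trans; cong; cong₂; subst; module ≡-Reasoning)
open import Relation.Nullary.Decidable
  using (Dec; yes; no; does; from-yes; from-no; map′; dec-true; _×-dec_; _→-dec_)
open import Relation.Nullary.Negation using (¬_; contradiction)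
open import Relation.Unary using (Pred; Decidable)

private
  variable
    ℓ : Level
    n : ℕ

-- Signs

-- `Sign` has two elements, so a sign identity in several variables can be proved by evaluating its
-- decision procedure on all assignments.
∀-sign? : {P : Pred Sign ℓ} → Decidable P → Dec (∀ s → P s)
∀-sign? P? = map′ (λ { (p , q) - → p ; (p , q) + → q }) (λ f → f - , f +) (P? - ×-dec P? +)

[-1]^_ : ℕ → Sign
[-1]^ zero  = +
[-1]^ suc k = opposite ([-1]^ k)

[-1]^-even : ∀ k → 2 ∣ k → [-1]^ k ≡ +
[-1]^-even 0             _ = refl
[-1]^-even 1             d = contradiction d (from-no (2 ∣? 1))
[-1]^-even (suc (suc k)) d =
  trans (opposite-involutive _) ([-1]^-even k (∣m+n∣m⇒∣n d ∣-refl))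

[-1]^-odd : ∀ k → ¬ 2 ∣ k → [-1]^ k ≡ -
[-1]^-odd 0             ¬d = contradiction (2 ∣0) ¬d
[-1]^-odd 1             _  = refl
[-1]^-odd (suc (suc k)) ¬d =
  trans (opposite-involutive _) ([-1]^-odd k (¬d ∘ ∣m∣n⇒∣m+n ∣-refl))

infixr 8 _·_

-- Defined by cases, so that at a literal sign the result reduces to `z` or `ℤ.- z`, the very
-- entries of the block forms.
_·_ : Sign → ℤ → ℤ
+ · z = z
- · z = ℤ.- z

·-◃ : ∀ s t → (s * t) ◃ 1 ≡ s · (t ◃ 1)
·-◃ + _ = refl
·-◃ - + = refl
·-◃ - - = refl

·-0ℤ : ∀ s → s · 0ℤ ≡ 0ℤ
·-0ℤ + = refl
·-0ℤ - = refl

◃1-entry : ∀ s → s ◃ 1 ≡ 0ℤ ⊎ s ◃ 1 ≡ 1ℤ ⊎ s ◃ 1 ≡ -1ℤ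
◃1-entry + = inj₂ (inj₁ refl)
◃1-entry - = inj₂ (inj₂ refl)

-- Subsets

does⁻ : {P : Set ℓ} (P? : Dec P) → does P? ≡ true → P
does⁻ (yes p) _ = p

∈-tabulate⁺ : ∀ {f : Fin n → Bool} {v} → f v ≡ true → v ∈ tabulate f
∈-tabulate⁺ {v = v} eq = lookup⇒[]= v _ (trans (lookup∘tabulate _ v) eq)

∈-tabulate⁻ : ∀ {f : Fin n → Bool} {v} → v ∈ tabulate f → f v ≡ true
∈-tabulate⁻ {v = v} v∈ = trans (sym (lookup∘tabulate _ v)) ([]=⇒lookup v∈)

lookup-injective : ∀ {A : Set ℓ} {xs : List A} → Unique xs → Injective _≡_ _≡_ (List.lookup xs)
lookup-injective (_ ∷ _)   {zero}  {zero}  _  = refl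
lookup-injective (x∉ ∷ _)  {zero}  {suc j} eq = contradiction eq (All.lookup x∉ (∈-lookup j))
lookup-injective (x∉ ∷ _)  {suc i} {zero}  eq = contradiction (sym eq) (All.lookup x∉ (∈-lookup i))
lookup-injective (_ ∷ xs!) {suc i} {suc j} eq = cong suc (lookup-injective xs! eq)

enumeration : (S : Subset n) → ∃ λ s → ∃ λ (ω : Vector (Fin n) s) → Enumerates ω S
enumeration {n} S = List.length members , List.lookup members , record
  { injective = lookup-injective (filter⁺ (_∈? S) (allFin⁺ n))
  ; member    = λ i → proj₂ (∈-filter⁻ (_∈? S) {xs = List.allFin n} (∈-lookup i))
  ; complete  = λ {v} v∈S →
      let v∈ = ∈-filter⁺ (_∈? S) (∈-allFin v) v∈S in index v∈ , sym (lookup-index v∈)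
  }
  where
  members : List (Fin n)
  members = List.filter (_∈? S) (List.allFin n)

-- The switching function of `U`: switching multiplies the sign of an edge by the values at its two
-- ends.
indicator : Subset n → Fin n → Sign
indicator U v = if lookup U v then - else +

∈⇒indicator : ∀ {U : Subset n} {v} → v ∈ U → indicator U v ≡ -
∈⇒indicator v∈U = cong (if_then - else +) ([]=⇒lookup v∈U)

∉⇒indicator : ∀ {U : Subset n} {v} → v ∉ U → indicator U v ≡ +
∉⇒indicator {U = U} {v} v∉U with lookup U v in eq
... | true  = contradiction (lookup⇒[]= v U eq) v∉U
... | false = refl

-- Matrices

-- Concatenation of index vectors and stacking of matrices both branch on the same `splitAt`. This
-- lemma and its column analogue therefore peel off one block at a time.
⫽-intro : ∀ {m p q : ℕ} {I J : Set} (R : I → J → ℤ) (f : Vector I p) (g : Vector I q)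
          (h : Vector J m) {M : Matrix p m} {N : Matrix q m} →
          (λ i j → R (f i) (h j)) ≈ M → (λ i j → R (g i) (h j)) ≈ N →
          (λ i j → R ((f ++ g) i) (h j)) ≈ M ⫽ N
⫽-intro {p = p} R f g h f≈ g≈ i j with splitAt p i
... | inj₁ k = f≈ k j
... | inj₂ k = g≈ k j

∥-intro : ∀ {m p q : ℕ} {I J : Set} (R : I → J → ℤ) (h : Vector I m)
          (f : Vector J p) (g : Vector J q) {M : Matrix m p} {N : Matrix m q} →
          (λ i j → R (h i) (f j)) ≈ M → (λ i j → R (h i) (g j)) ≈ N →
          (λ i j → R (h i) ((f ++ g) j)) ≈ M ∥ N
∥-intro {p = p} R h f g f≈ g≈ i j with splitAt p j
... | inj₁ k = f≈ i k
... | inj₂ k = g≈ i k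

-- Switching and entries of the adjacency matrix

module _ {G : Graph n} where

  -- Once the endpoints are identified, only the adjacency proofs differ, and `σ` takes these
  -- irrelevantly.
  σ-cong : (Γ : SignedGraph G) → ∀ {u v u′ v′} (e : Adj G u v) (e′ : Adj G u′ v′) →
           u ≡ u′ → v ≡ v′ → σ Γ e ≡ σ Γ e′
  σ-cong Γ _ _ refl refl = refl

  σ-switch : ∀ U (Γ : SignedGraph G) {u v} (e : Adj G u v) →
             σ (switch U Γ) e ≡ indicator U u * indicator U v * σ Γ e
  σ-switch U Γ {u} {v} e with lookup U u | lookup U v
  ... | true  | true  = refl
  ... | true  | false = refl
  ... | false | true  = refl
  ... | false | false = refl

  -- Switching twice with respect to the same set restores every sign, so the identity map is the
  -- required isomorphism.
  switch-≃ : ∀ U (Γ : SignedGraph G) → Γ ≃ switch U Γ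
  switch-≃ U Γ = U , record
    { iso            = record { perm = Perm.id ; preserves = λ e → e ; reflects = λ e → e }
    ; sign-preserved = λ {u} {v} e →
        trans (σ-switch U (switch U Γ) e)
          (trans (cong (indicator U u * indicator U v *_) (σ-switch U Γ e))
            (cancel (indicator U u) (indicator U v) (σ Γ e)))
    }
    where
    cancel : ∀ a b c → a * b * (a * b * c) ≡ c
    cancel = from-yes (∀-sign? λ a → ∀-sign? λ b → ∀-sign? λ c → a * b * (a * b * c) Sign.≟ c)

  module _ (Γ : SignedGraph G) where

    adjacencyMatrix-edge : ∀ {u v} (e : Adj G u v) → adjacencyMatrix Γ u v ≡ σ Γ e ◃ 1
    adjacencyMatrix-edge {u} {v} e with adj? G u v
    ... | yes _  = refl
    ... | no ¬e = contradiction e ¬e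

    adjacencyMatrix-nonedge : ∀ {u v} → ¬ Adj G u v → adjacencyMatrix Γ u v ≡ 0ℤ
    adjacencyMatrix-nonedge {u} {v} ¬e with adj? G u v
    ... | yes e = contradiction e ¬e
    ... | no _  = refl

    adjacencyMatrix-entries : SignEntries (adjacencyMatrix Γ)
    adjacencyMatrix-entries u v with adj? G u v
    ... | yes e = ◃1-entry (σ Γ e)
    ... | no _  = inj₁ refl

    adjacencyMatrix-scale : ∀ {u v u′ v′} s → (Adj G u v → Adj G u′ v′) →
                            (Adj G u′ v′ → Adj G u v) →
                            (∀ (e : Adj G u v) (e′ : Adj G u′ v′) → σ Γ e′ ≡ s * σ Γ e) →
                            adjacencyMatrix Γ u′ v′ ≡ s · adjacencyMatrix Γ u v
    adjacencyMatrix-scale {u} {v} {u′} {v′} s to from σ≡ with adj? G u v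
    ... | yes e = trans (adjacencyMatrix-edge (to e))
                    (trans (cong (_◃ 1) (σ≡ e (to e))) (·-◃ s (σ Γ e)))
    ... | no ¬e = trans (adjacencyMatrix-nonedge (¬e ∘ from)) (sym (·-0ℤ s))

    adjacencyMatrix-sym : ∀ u v → adjacencyMatrix Γ v u ≡ adjacencyMatrix Γ u v
    adjacencyMatrix-sym u v =
      adjacencyMatrix-scale + (adj-sym G) (adj-sym G) (λ e _ → σ-sym Γ e)

-- Balance

module _ {G : Graph n} (Δ : SignedGraph G) where

  Balanced : Set
  Balanced = ∀ C → cycleSign Δ C ≡ +

  private
    verts : ∀ {u v} → Star (Adj G) u v → List (Fin n)
    verts = vertices {G = G}

  pathSign-◅◅ : ∀ {u v w} (p : Star (Adj G) u v) (q : Star (Adj G) v w) →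
                pathSign Δ (p ◅◅ q) ≡ pathSign Δ p * pathSign Δ q
  pathSign-◅◅ ε       q = refl
  pathSign-◅◅ (e ◅ p) q =
    trans (cong (σ Δ e *_) (pathSign-◅◅ p q)) (sym (Sign.*-assoc (σ Δ e) _ _))

  end∈vertices : ∀ {u v} (p : Star (Adj G) u v) → v ∈ₗ verts p
  end∈vertices ε       = here refl
  end∈vertices (_ ◅ p) = there (end∈vertices p)

  -- The inclusion `verts q ⊆ₗ verts p` is carried along because the recursion needs it: a vertex
  -- absent from `p` is then absent from the prefix `q`, which stays free of repetitions when
  -- extended.
  split-path : ∀ {u v x} (p : Star (Adj G) u v) → Unique (verts p) → x ∈ₗ verts p →
               ∃₂ λ (q : Star (Adj G) u x) (r : Star (Adj G) x v) →
                 (verts q ⊆ₗ verts p × Unique (verts q)) × Unique (verts r) ×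
                 pathSign Δ p ≡ pathSign Δ q * pathSign Δ r
  split-path ε       p! (here refl) = ε , ε , ((λ z∈ → z∈) , p!) , p! , refl
  split-path (e ◅ p) p! (here refl) =
    ε , e ◅ p , ((λ { (here eq) → here eq }) , All.[] ∷ []) , p! , refl
  split-path (e ◅ p) (u∉p ∷ p!) (there x∈p) with split-path p p! x∈p
  ... | q , r , (q⊆p , q!) , r! , eq =
    e ◅ q , r , ((λ { (here eq) → here eq ; (there z∈q) → there (q⊆p z∈q) })
                , anti-mono q⊆p u∉p ∷ q!) , r! ,
    trans (cong (σ Δ e *_) eq) (sym (Sign.*-assoc (σ Δ e) _ _))

  module _ (balanced : Balanced) where

    -- Three cases by the length of `p`: length 0 would make `e` a loop, length 1 runs back along
    -- the same edge and gives a square, and from length 2 on there is a genuine cycle.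
    cycle-positive : ∀ {u v} (e : Adj G u v) (p : Star (Adj G) v u) → Unique (verts p) →
                     σ Δ e * pathSign Δ p ≡ +
    cycle-positive e ε              _  = contradiction e (adj-irrefl G refl)
    cycle-positive e (e′ ◅ ε)       _  =
      trans (cong (σ Δ e *_) (trans (Sign.*-identityʳ _) (σ-sym Δ e))) (s*s≡+ (σ Δ e))
    cycle-positive e (e′ ◅ e″ ◅ p)  p! = balanced record
      { path = e′ ◅ e″ ◅ p ; closing = e ; distinct = p! ; long = s≤s (s≤s z≤n) }

    loop-erasure : ∀ {u v} (w : Star (Adj G) u v) →
                   ∃ λ (p : Star (Adj G) u v) → Unique (verts p) × pathSign Δ p ≡ pathSign Δ w
    loop-erasure ε = ε , All.[] ∷ [] , refl
    loop-erasure {u} (e ◅ w) with loop-erasure w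
    ... | p , p! , p≡w with ∈-dec _≟_ u (verts p)
    ...   | no u∉p = e ◅ p , ¬Any⇒All¬ _ u∉p ∷ p! , cong (σ Δ e *_) p≡w
    -- The walk returns to `u`. The edge `e` and the prefix `q` close up with sign `+`, so only the
    -- remainder `r` is kept, without changing the sign.
    ...   | yes u∈p with split-path p p! u∈p
    ...     | q , r , (_ , q!) , r! , p≡qr = r , r! , (begin
      pathSign Δ r                          ≡⟨ cong (_* pathSign Δ r) (cycle-positive e q q!) ⟨
      σ Δ e * pathSign Δ q * pathSign Δ r   ≡⟨ Sign.*-assoc (σ Δ e) _ _ ⟩
      σ Δ e * (pathSign Δ q * pathSign Δ r) ≡⟨ cong (σ Δ e *_) (trans (sym p≡qr) p≡w) ⟩
      σ Δ e * pathSign Δ w                  ∎)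
      where open ≡-Reasoning

    -- Loop erasure must leave the empty path, since a nonempty one from `u` to `u` would repeat
    -- `u`.
    closed-walk-positive : ∀ {u} (w : Star (Adj G) u u) → pathSign Δ w ≡ +
    closed-walk-positive w with loop-erasure w
    ... | ε     , _          , eq = sym eq
    ... | _ ◅ p , (u∉p ∷ _)  , _  = contradiction refl (All.lookup u∉p (end∈vertices p))

    round-trip-positive : ∀ {u v} (p : Star (Adj G) u v) (q : Star (Adj G) v u) →
                          pathSign Δ p * pathSign Δ q ≡ +
    round-trip-positive p q = trans (sym (pathSign-◅◅ p q)) (closed-walk-positive (p ◅◅ q))

    -- Harary's criterion: θ(v) is the sign of a chosen walk from a root to v. For an edge uv, the
    -- closed walks root-v-root and root-u-v-root share their return walk from v, and comparing
    -- their signs gives the sign of the edge.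
    potential : Connected G → ∃ λ θ → ∀ {u v} (e : Adj G u v) → σ Δ e ≡ θ u * θ v
    potential ((root , _) , connected) = (λ v → pathSign Δ (to v)) , λ {u} {v} e →
      insert (pathSign Δ (to u)) (σ Δ e) (pathSign Δ (to v)) (pathSign Δ (from v))
        (round-trip-positive (to v) (from v)) (round-trip-positive (to u) (e ◅ from v))
      where
      walk : ∀ u v → Star (Adj G) u v
      walk u v = mapStar (λ (_ , _ , e) → e) (connected {u} {v} ∈⊤ ∈⊤)

      to : ∀ v → Star (Adj G) root v
      to = walk root

      from : ∀ v → Star (Adj G) v root
      from v = walk v root

      insert : ∀ a b c d → c * d ≡ + → a * (b * d) ≡ + → b ≡ a * c
      insert = from-yes (∀-sign? λ a → ∀-sign? λ b → ∀-sign? λ c → ∀-sign? λ d →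
        (c * d Sign.≟ +) →-dec ((a * (b * d) Sign.≟ +) →-dec (b Sign.≟ a * c)))

-- Weak automorphisms

module _ {G : Graph n} (φ : Aut G) where

  ∈-image⁺ : ∀ {S v} → v ∈ S → ⟦ φ ⟧ v ∈ image φ S
  ∈-image⁺ {S} v∈S = ∈-tabulate⁺ (trans (cong (lookup S) (inverseˡ (perm φ))) ([]=⇒lookup v∈S))

  ∈-image⁻ : ∀ {S v} → v ∈ image φ S → perm φ ⟨$⟩ˡ v ∈ S
  ∈-image⁻ {S} {v} v∈ = lookup⇒[]= _ S (∈-tabulate⁻ v∈)

  ∈-Fix⁻ : ∀ {v} → v ∈ Fix φ → ⟦ φ ⟧ v ≡ v
  ∈-Fix⁻ {v} v∈F = does⁻ (⟦ φ ⟧ v ≟ v) (∈-tabulate⁻ v∈F)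

  image-enumerates : ∀ {s S} {ω : Vector (Fin n) s} →
                     Enumerates ω S → Enumerates (⟦ φ ⟧ ∘ ω) (image φ S)
  image-enumerates enum = record
    { injective = injective ∘ ⟦⟧-injective φ
    ; member    = λ i → ∈-image⁺ (member i)
    ; complete  = λ v∈ → let i , eq = complete (∈-image⁻ v∈) in
                         i , trans (cong ⟦ φ ⟧ eq) (inverseʳ (perm φ))
    }
    where open Enumerates enum

  module _ (Γ : SignedGraph G) where

    discrepancy : SignedGraph G
    discrepancy = record
      { σ     = λ e → opposite (σ Γ e * σ Γ (preserves φ e))
      ; σ-sym = λ e → cong opposite (cong₂ _*_ (σ-sym Γ e) (σ-sym Γ (preserves φ e)))
      }

    -- The minus sign in the discrepancy contributes one factor per edge; this is how the parity of
    -- the cycle length enters.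
    pathSign-discrepancy : ∀ {u v} (p : Star (Adj G) u v) →
                           pathSign discrepancy p ≡
                           [-1]^ edgeCount {G = G} p * (pathSign Γ p * pathSign Γ (mapPath φ p))
    pathSign-discrepancy ε       = refl
    pathSign-discrepancy (e ◅ p) =
      trans (cong (opposite (σ Γ e * σ Γ (preserves φ e)) *_) (pathSign-discrepancy p))
        (rearrange (σ Γ e) (σ Γ (preserves φ e)) ([-1]^ edgeCount {G = G} p) _ _)
      where
      rearrange : ∀ a b k c d → opposite (a * b) * (k * (c * d)) ≡ opposite k * (a * c * (b * d))
      rearrange = from-yes (∀-sign? λ a → ∀-sign? λ b → ∀-sign? λ k → ∀-sign? λ c → ∀-sign? λ d →
        opposite (a * b) * (k * (c * d)) Sign.≟ opposite k * (a * c * (b * d)))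

    discrepancy-balanced : IsWeakAutomorphism Γ φ → Balanced discrepancy
    discrepancy-balanced weak C =
      -- For the closed walk `closing C ◅ path C`, `pathSign` and `edgeCount` reduce to `cycleSign`
      -- and `cycleLength`. For odd length the factor `-` from the parity cancels the sign reversal
      -- under φ.
      trans (pathSign-discrepancy (closing C ◅ path C)) parity
      where
      open IsWeakAutomorphism weak
      c = cycleSign Γ C

      parity : [-1]^ cycleLength C * (c * cycleSign Γ (mapCycle φ C)) ≡ +
      parity with 2 ∣? cycleLength C
      ... | yes d  = trans (cong₂ _*_ ([-1]^-even _ d) (cong (c *_) (even-cycles C d))) (s*s≡+ c)
      ... | no ¬d = trans (cong₂ _*_ ([-1]^-odd _ ¬d) (cong (c *_) (odd-cycles C ¬d)))
                      (cong opposite (Sign.s*opposite[s]≡- c))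

-- The potential of a weak involution and the bipartition of its fixed set

module WeakInvolution
  (G : Graph n) (connected : Connected G) (Γ : SignedGraph G)
  (φ : Aut G) (weak : IsWeakAutomorphism Γ φ) (involutive : ∀ v → ⟦ φ ⟧ (⟦ φ ⟧ v) ≡ v)
  (fixed : Nonempty (Fix φ))
  where

  private
    Δ = discrepancy φ Γ
    potentialΔ = potential Δ (discrepancy-balanced φ Γ weak) connected

  θ : Fin n → Sign
  θ = proj₁ potentialΔ

  θ-edge : ∀ {u v} (e : Adj G u v) → σ Δ e ≡ θ u * θ v
  θ-edge = proj₂ potentialΔ

  -- As φ is an involution, it merely exchanges the two factors σ(e) and σ(φ(e)).
  Δ-invariant : ∀ {u v} (e : Adj G u v) → σ Δ (preserves φ e) ≡ σ Δ e
  Δ-invariant {u} {v} e = cong opposite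
    (trans (cong (σ Γ (preserves φ e) *_)
             (σ-cong Γ (preserves φ (preserves φ e)) e (involutive u) (involutive v)))
      (Sign.*-comm (σ Γ (preserves φ e)) (σ Γ e)))

  -- By invariance of `Δ`, both θ and θ ∘ φ are potentials for it, so agreement at one end of an
  -- edge passes to the other. It holds at a fixed vertex and spreads along walks.
  θ-invariant : ∀ v → θ (⟦ φ ⟧ v) ≡ θ v
  θ-invariant v = along (proj₂ connected {f} {v} ∈⊤ ∈⊤) (cong θ (∈-Fix⁻ φ (proj₂ fixed)))
    where
    f = proj₁ fixed

    cancel : ∀ a b c d → a ≡ b → a * c ≡ b * d → c ≡ d
    cancel a b c d refl eq = Sign.*-cancelˡ-≡ a c d eq

    along : ∀ {u v} → Star (Induced G ⊤) u v → θ (⟦ φ ⟧ u) ≡ θ u → θ (⟦ φ ⟧ v) ≡ θ v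
    along ε                 eq = eq
    along ((_ , _ , e) ◅ p) eq = along p (cancel _ _ _ _ eq
      (trans (sym (θ-edge (preserves φ e))) (trans (Δ-invariant e) (θ-edge e))))

  σ-image : ∀ {u v} (e : Adj G u v) → σ Γ (preserves φ e) ≡ opposite (θ u * θ v) * σ Γ e
  σ-image e = solveFor (σ Γ e) (σ Γ (preserves φ e)) _ (θ-edge e)
    where
    solveFor : ∀ a b c → opposite (a * b) ≡ c → b ≡ opposite c * a
    solveFor = from-yes (∀-sign? λ a → ∀-sign? λ b → ∀-sign? λ c →
      (opposite (a * b) Sign.≟ c) →-dec (b Sign.≟ opposite c * a))

  θ⁻ : Subset n
  θ⁻ = tabulate λ v → does (θ v Sign.≟ -)

  ∈θ⁻⇒θ : ∀ {v} → v ∈ θ⁻ → θ v ≡ -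
  ∈θ⁻⇒θ {v} v∈ = does⁻ (θ v Sign.≟ -) (∈-tabulate⁻ v∈)

  ∉θ⁻⇒θ : ∀ {v} → v ∉ θ⁻ → θ v ≡ +
  ∉θ⁻⇒θ {v} v∉ with θ v in eq
  ... | + = refl
  ... | - = contradiction (∈-tabulate⁺ (dec-true (θ v Sign.≟ -) eq)) v∉

  Ω₁ Ω₂ : Subset n
  Ω₁ = Fix φ ∩ θ⁻
  Ω₂ = Fix φ ∩ ∁ θ⁻

  ∈Ω₁⁻ : ∀ {v} → v ∈ Ω₁ → v ∈ Fix φ × θ v ≡ -
  ∈Ω₁⁻ v∈ = let v∈F , v∈θ = x∈p∩q⁻ _ _ v∈ in v∈F , ∈θ⁻⇒θ v∈θ

  ∈Ω₂⁻ : ∀ {v} → v ∈ Ω₂ → v ∈ Fix φ × θ v ≡ +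
  ∈Ω₂⁻ v∈ = let v∈F , v∈θ = x∈p∩q⁻ _ _ v∈ in v∈F , ∉θ⁻⇒θ (x∈∁p⇒x∉p v∈θ)

  -- φ fixes both ends of such an edge, so its sign would equal its own opposite.
  θ-separates : ∀ {u v} → u ∈ Fix φ → v ∈ Fix φ → θ u ≡ θ v → ¬ Adj G u v
  θ-separates {u} {v} u∈F v∈F θu≡θv e = Sign.s≢opposite[s] (σ Γ e) (begin
    σ Γ e                        ≡⟨ σ-cong Γ (preserves φ e) e (∈-Fix⁻ φ u∈F) (∈-Fix⁻ φ v∈F) ⟨
    σ Γ (preserves φ e)          ≡⟨ σ-image e ⟩
    opposite (θ u * θ v) * σ Γ e ≡⟨ cong (λ s → opposite (s * θ v) * σ Γ e) θu≡θv ⟩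
    opposite (θ v * θ v) * σ Γ e ≡⟨ cong (λ s → opposite s * σ Γ e) (s*s≡+ (θ v)) ⟩
    opposite (σ Γ e)             ∎)
    where open ≡-Reasoning

  bipartition : IsBipartition G (Fix φ) Ω₁ Ω₂
  bipartition = record
    { cover        = sym (trans (sym (∩-distribˡ-∪ (Fix φ) θ⁻ (∁ θ⁻)))
                       (trans (cong (Fix φ ∩_) (p∪∁p≡⊤ θ⁻)) (∩-identityʳ (Fix φ))))
    ; disjoint     = λ (v , v∈) → let v∈₁ , v∈₂ = x∈p∩q⁻ Ω₁ Ω₂ v∈ in
                       contradiction (trans (sym (proj₂ (∈Ω₁⁻ v∈₁))) (proj₂ (∈Ω₂⁻ v∈₂))) λ ()
    ; independent₁ = λ u∈ v∈ → separate (∈Ω₁⁻ u∈) (∈Ω₁⁻ v∈)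
    ; independent₂ = λ u∈ v∈ → separate (∈Ω₂⁻ u∈) (∈Ω₂⁻ v∈)
    }
    where
    separate : ∀ {s u v} → u ∈ Fix φ × θ u ≡ s → v ∈ Fix φ × θ v ≡ s → ¬ Adj G u v
    separate (u∈F , θu) (v∈F , θv) = θ-separates u∈F v∈F (trans θu (sym θv))

  -- The switched signed graph and its block form

  module _ {S U₁ U₂ : Subset n} (halving : IsHalving φ S U₁ U₂) where

    open IsHalving halving using (disjoint; swap₁; swap₂)

    private
      not-both : ∀ {v} → v ∈ U₁ → v ∉ U₂
      not-both v∈U₁ v∈U₂ = disjoint (_ , x∈p∩q⁺ (v∈U₁ , v∈U₂))

      φ-U₁ : ∀ {v} → v ∈ U₁ → ⟦ φ ⟧ v ∈ U₂
      φ-U₁ v∈ = subst (_ ∈_) swap₁ (∈-image⁺ φ v∈)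

      φ-U₂ : ∀ {v} → v ∈ U₂ → ⟦ φ ⟧ v ∈ U₁
      φ-U₂ v∈ = subst (_ ∈_) swap₂ (∈-image⁺ φ v∈)

    χ : Fin n → Sign
    χ = indicator (U₂ ∩ θ⁻)

    χ-U₂ : ∀ {v} → v ∈ U₂ → χ v ≡ θ v
    χ-U₂ {v} v∈ with v ∈? θ⁻
    ... | yes v∈θ = trans (∈⇒indicator (x∈p∩q⁺ (v∈ , v∈θ))) (sym (∈θ⁻⇒θ v∈θ))
    ... | no v∉θ  = trans (∉⇒indicator (v∉θ ∘ proj₂ ∘ x∈p∩q⁻ U₂ θ⁻)) (sym (∉θ⁻⇒θ v∉θ))

    χ-∉U₂ : ∀ {v} → v ∉ U₂ → χ v ≡ +
    χ-∉U₂ v∉ = ∉⇒indicator (v∉ ∘ proj₁ ∘ x∈p∩q⁻ U₂ θ⁻)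

    Γ̂ : SignedGraph G
    Γ̂ = switch (U₂ ∩ θ⁻) Γ

    K : Matrix n n
    K = adjacencyMatrix Γ̂

    τ : Fin n → Sign
    τ v = χ (⟦ φ ⟧ v) * χ v * θ v

    τ-U₁ : ∀ {v} → v ∈ U₁ → τ v ≡ +
    τ-U₁ {v} v∈ = trans
      (cong (_* θ v) (cong₂ _*_ (trans (χ-U₂ (φ-U₁ v∈)) (θ-invariant v)) (χ-∉U₂ (not-both v∈))))
      (trans (cong (_* θ v) (Sign.*-identityʳ (θ v))) (s*s≡+ (θ v)))

    τ-U₂ : ∀ {v} → v ∈ U₂ → τ v ≡ +
    τ-U₂ {v} v∈ = trans
      (cong (_* θ v) (cong₂ _*_ (χ-∉U₂ (not-both (φ-U₂ v∈))) (χ-U₂ v∈)))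
      (s*s≡+ (θ v))

    τ-Fix : ∀ {v} → v ∈ Fix φ → τ v ≡ θ v
    τ-Fix {v} v∈ =
      cong (_* θ v) (trans (cong (λ w → χ w * χ v) (∈-Fix⁻ φ v∈)) (s*s≡+ (χ v)))

    -- The values of τ enter through equations, so that callers obtain literal signs on which `·`
    -- computes.
    K-image : ∀ {s t u v} → τ u ≡ s → τ v ≡ t → K (⟦ φ ⟧ u) (⟦ φ ⟧ v) ≡ opposite (s * t) · K u v
    K-image {u = u} {v} refl refl =
      adjacencyMatrix-scale Γ̂ (opposite (τ u * τ v)) (preserves φ) (reflects φ) λ e e′ → begin
        σ Γ̂ e′
          ≡⟨ σ-switch (U₂ ∩ θ⁻) Γ e′ ⟩
        χ (⟦ φ ⟧ u) * χ (⟦ φ ⟧ v) * σ Γ e′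
          ≡⟨ cong (χ (⟦ φ ⟧ u) * χ (⟦ φ ⟧ v) *_) (σ-image e) ⟩
        χ (⟦ φ ⟧ u) * χ (⟦ φ ⟧ v) * (opposite (θ u * θ v) * σ Γ e)
          ≡⟨ rearrange (χ (⟦ φ ⟧ u)) (χ (⟦ φ ⟧ v)) (χ u) (χ v) (θ u) (θ v) (σ Γ e) ⟩
        opposite (τ u * τ v) * (χ u * χ v * σ Γ e)
          ≡⟨ cong (opposite (τ u * τ v) *_) (σ-switch (U₂ ∩ θ⁻) Γ e) ⟨
        opposite (τ u * τ v) * σ Γ̂ e ∎
      where
      open ≡-Reasoning

      rearrange : ∀ a b c d x y s → a * b * (opposite (x * y) * s) ≡
                  opposite (a * c * x * (b * d * y)) * (c * d * s)
      rearrange = from-yes (∀-sign? λ a → ∀-sign? λ b → ∀-sign? λ c → ∀-sign? λ d →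
        ∀-sign? λ x → ∀-sign? λ y → ∀-sign? λ s →
        a * b * (opposite (x * y) * s) Sign.≟ opposite (a * c * x * (b * d * y)) * (c * d * s))

    K-U₁U₁ : ∀ {u v} → u ∈ U₁ → v ∈ U₁ → K (⟦ φ ⟧ u) (⟦ φ ⟧ v) ≡ ℤ.- K u v
    K-U₁U₁ u∈ v∈ = K-image (τ-U₁ u∈) (τ-U₁ v∈)

    -- This is `K-image` for the pair u, φ(v), since φ carries φ(v) back to v. It gives both the
    -- block `− Y` and the skewness of `Y`.
    K-U₂U₁ : ∀ {u v} → u ∈ U₁ → v ∈ U₁ → K (⟦ φ ⟧ u) v ≡ ℤ.- K u (⟦ φ ⟧ v)
    K-U₂U₁ {u} {v} u∈ v∈ = trans (cong (K (⟦ φ ⟧ u)) (sym (involutive v)))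
                             (K-image (τ-U₁ u∈) (τ-U₂ (φ-U₁ v∈)))

    -- On `Ω₁`, where θ is `-`, the factor is `+` and `D₁` is repeated; on `Ω₂`, where θ is `+`, it
    -- is `-` and `D₂` is negated.
    K-FixU₂ : ∀ {s f v} → f ∈ Fix φ × θ f ≡ s → v ∈ U₁ → K f (⟦ φ ⟧ v) ≡ opposite s · K f v
    K-FixU₂ {s} {f} {v} (f∈ , θf) v∈ =
      trans (cong (λ w → K w (⟦ φ ⟧ v)) (sym (∈-Fix⁻ φ f∈)))
        (trans (K-image (trans (τ-Fix f∈) θf) (τ-U₁ v∈))
          (cong (λ t → opposite t · K f v) (Sign.*-identityʳ s)))

    K-U₂Fix : ∀ {s f v} → f ∈ Fix φ × θ f ≡ s → v ∈ U₁ → K (⟦ φ ⟧ v) f ≡ opposite s · K f v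
    K-U₂Fix f∈ v∈ = trans (adjacencyMatrix-sym Γ̂ _ _) (K-FixU₂ f∈ v∈)

    hasFormᵃ : HasForm formᵃ φ Ω₁ Ω₂ U₁ U₂ Γ̂
    hasFormᵃ with enumeration Ω₁ | enumeration Ω₂ | enumeration U₁
    ... | a , ω₁ , enum-ω₁ | b , ω₂ , enum-ω₂ | c , u₁ , enum-u₁ = record
      { ω₁ = ω₁ ; ω₂ = ω₂ ; u₁ = u₁ ; u₂ = u₂
      ; enum-ω₁ = enum-ω₁ ; enum-ω₂ = enum-ω₂ ; enum-u₁ = enum-u₁
      ; enum-u₂ = subst (Enumerates u₂) swap₁ (image-enumerates φ enum-u₁)
      ; aligned = λ _ → refl
      ; blocks  = blocks
      ; matrix  =
          ⫽-intro K ω₁ _ _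
            (∥-intro K ω₁ ω₁ _ (λ i j → zero-block (independent₁ (∈Ω₁ i) (∈Ω₁ j)))
            (∥-intro K ω₁ ω₂ _ (λ _ _ → refl)
            (∥-intro K ω₁ u₁ u₂ (λ _ _ → refl)
              (λ i j → K-FixU₂ (∈Ω₁⁻ (∈Ω₁ i)) (∈U₁ j)))))
          (⫽-intro K ω₂ _ _
            (∥-intro K ω₂ ω₁ _ (λ _ _ → adjacencyMatrix-sym Γ̂ _ _)
            (∥-intro K ω₂ ω₂ _ (λ i j → zero-block (independent₂ (∈Ω₂ i) (∈Ω₂ j)))
            (∥-intro K ω₂ u₁ u₂ (λ _ _ → refl)
              (λ i j → K-FixU₂ (∈Ω₂⁻ (∈Ω₂ i)) (∈U₁ j)))))
          (⫽-intro K u₁ u₂ _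
            (∥-intro K u₁ ω₁ _ (λ _ _ → adjacencyMatrix-sym Γ̂ _ _)
            (∥-intro K u₁ ω₂ _ (λ _ _ → adjacencyMatrix-sym Γ̂ _ _)
            (∥-intro K u₁ u₁ u₂ (λ _ _ → refl) (λ _ _ → refl))))
            (∥-intro K u₂ ω₁ _ (λ i j → K-U₂Fix (∈Ω₁⁻ (∈Ω₁ j)) (∈U₁ i))
            (∥-intro K u₂ ω₂ _ (λ i j → K-U₂Fix (∈Ω₂⁻ (∈Ω₂ j)) (∈U₁ i))
            (∥-intro K u₂ u₁ u₂
              (λ i j → K-U₂U₁ (∈U₁ i) (∈U₁ j))
              (λ i j → K-U₁U₁ (∈U₁ i) (∈U₁ j)))))))
      }
      where
      open IsBipartition bipartition using (independent₁; independent₂)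
      open Enumerates enum-ω₁ using () renaming (member to ∈Ω₁)
      open Enumerates enum-ω₂ using () renaming (member to ∈Ω₂)
      open Enumerates enum-u₁ using () renaming (member to ∈U₁)

      u₂ : Vector (Fin n) c
      u₂ = ⟦ φ ⟧ ∘ u₁

      zero-block : ∀ {u v} → ¬ Adj G u v → K u v ≡ 0ℤ
      zero-block = adjacencyMatrix-nonedge Γ̂

      blocks : Blocks a b c
      blocks = record
        { A  = λ i j → K (ω₁ i) (ω₂ j)
        ; B  = λ i j → K (u₁ i) (u₁ j)
        ; Y  = λ i j → K (u₁ i) (u₂ j)
        ; D₁ = λ i j → K (ω₁ i) (u₁ j)
        ; D₂ = λ i j → K (ω₂ i) (u₁ j)
        ; A-entries   = λ _ _ → adjacencyMatrix-entries Γ̂ _ _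
        ; B-entries   = λ _ _ → adjacencyMatrix-entries Γ̂ _ _
        ; Y-entries   = λ _ _ → adjacencyMatrix-entries Γ̂ _ _
        ; D₁-entries  = λ _ _ → adjacencyMatrix-entries Γ̂ _ _
        ; D₂-entries  = λ _ _ → adjacencyMatrix-entries Γ̂ _ _
        ; B-symmetric = λ _ _ → adjacencyMatrix-sym Γ̂ _ _
        ; B-diagonal  = λ _ → zero-block (adj-irrefl G refl)
        -- Symmetry of `K` moves the transposed entry to the row of `u₂ i` and the column of `u₁ j`,
        -- where `K-U₂U₁` applies.
        ; Y-skew      = λ i j → trans (adjacencyMatrix-sym Γ̂ _ _) (K-U₂U₁ (∈U₁ i) (∈U₁ j))
        }

theorem4p4 : ∀ {n : ℕ} (G : Graph n) → Connected G → ¬ Bipartite G →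
    (Γ : SignedGraph G) → FS₁ Γ →
    (φ : Aut G) → IsPrincipal Γ φ → HasOrder φ 2 → Nonempty (Fix φ) →
    (U₁ U₂ : Subset n) → IsHalving φ (U₁ ∪ U₂) U₁ U₂ → IsUniqueFactor φ (U₁ ∪ U₂) →
    ∃₂ λ (Ω₁ Ω₂ : Subset n) → IsBipartition G (Fix φ) Ω₁ Ω₂ ×
    ∃ λ (Γ̂ : SignedGraph G) → Γ ≃ Γ̂ ×
    (HasForm formᵃ φ Ω₁ Ω₂ U₁ U₂ Γ̂ ⊎ HasForm formᵇ φ Ω₁ Ω₂ U₁ U₂ Γ̂)
theorem4p4 G connected _ Γ _ φ principal order fixed U₁ U₂ halving _ =
  -- With `Ω₁` the part where θ is `-`, the first form arises; exchanging the two parts would give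
  -- the second.
  Ω₁ , Ω₂ , bipartition , Γ̂ halving , switch-≃ (U₂ ∩ θ⁻) Γ , inj₁ (hasFormᵃ halving)
  where
  -- The identity power at exponent 2 reduces to φ(φ(v)) ≡ v, which is the involutivity required.
  open WeakInvolution G connected Γ φ
    (IsPrincipal.weak principal) (HasOrder.identity order) fixed
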